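{- Let $m\ge 2$ and $n\ge 4$, let $W_{m,n}=\overline{K}_m+C_n$ be the generalized wheel graph, and let $d:=n-m$. Then \[ \operatorname{nim}(\mathrm{TER}(W_{m,n}))=\begin{cases} 0, & n+m \text{ even and } 2\le d\\ 0, & n+m \text{ odd and } d \leq 0\\ 1, & n+m \text{ even and } d \leq 0\\ 1, & n+m \text{ odd and } 2\le d\\ 2, & d=1. \end{cases} \]
   Context: The generalized wheel graph $W_{m,n}$ is the join $\overline{K}_m+C_n$ of the edgeless graph on $m$ vertices and the cycle graph on $n$ vertices, i.e. their disjoint union together with all edges between the two vertex sets. For a graph $G$ with vertex set $V$, a set $K\subseteq V$ is convex if it contains every vertex lying on any shortest path between two elements of $K$. The convex hull $[P]$ of $P\subseteq V$ is the smallest convex set containing $P$. The game $\mathrm{TER}(G)$: positions are the sets $P\subseteq V$ reachable from the starting position $\emptyset$ by the following moves. If $[V\setminus P]=V$, then the options of $P$ are all sets $P\cup\{v\}$ with $v\in V\setminus P$; if $[V\setminus P]\neq V$, then $P$ is terminal (has no options). The nim-value of a position is defined recursively by $\operatorname{nim}(p)=\operatorname{mex}\{\operatorname{nim}(q): q\text{ an option of }p\}$, where $\operatorname{mex}(A)$ is the smallest nonnegative integer not in $A$; the nim-value of a game is that of its starting position. -}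

module Defs where

open import Data.Empty using () renaming (⊥ to Empty)
open import Data.Unit using () renaming (⊤ to Unit; tt to unit)
open import Data.Nat using (ℕ; suc; _+_; _≤_; _<_)
open import Data.Nat.Properties using (<-cmp)
open import Data.Fin using (Fin; toℕ; splitAt)
open import Data.Fin.Subset using (Subset; _∈_; _∉_; _⊆_; _∪_; ∁; ⁅_⁆; ⊤; ⊥)
open import Data.List using (List; []; _∷_)
open import Data.List.Membership.Propositional using () renaming (_∈_ to _∈ˡ_)
open import Data.List.Relation.Unary.Unique.Propositional using (Unique)
open import Data.Product using (∃; _×_; _,_)
open import Data.Sum using (_⊎_; inj₁; inj₂; swap)
open import Relation.Binary using (tri<; tri≈; tri>)
open import Relation.Binary.Construct.Closure.ReflexiveTransitive using (Star; ε)
open import Relation.Binary.PropositionalEquality using (_≡_; _≢_; refl; sym; trans)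
open import Relation.Nullary using (¬_; contradiction)

record Graph (k : ℕ) : Set₁ where
  field
    Adj    : Fin k → Fin k → Set
    symm   : ∀ {u v} → Adj u v → Adj v u
    irrefl : ∀ {v} → ¬ Adj v v

edgeless : ∀ m → Graph m
edgeless m = record { Adj = λ _ _ → Empty ; symm = λ () ; irrefl = λ () }

-- j is the cyclic successor of i in 0, 1, …, n-1.
Next : ∀ {n} → Fin n → Fin n → Set
Next {n} i j = toℕ j ≡ suc (toℕ i) ⊎ (suc (toℕ i) ≡ n × toℕ j ≡ 0)

-- The clause i ≢ j only matters for n = 1, where Next has a loop.
cycle : ∀ n → Graph n
cycle n = record
  { Adj    = λ i j → i ≢ j × (Next i j ⊎ Next j i)
  ; symm   = λ (i≢j , e) → (λ j≡i → i≢j (sym j≡i)) , swap e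
  ; irrefl = λ (v≢v , _) → v≢v refl
  }

module _ {m n} (G : Graph m) (H : Graph n) where
  private
    module G = Graph G
    module H = Graph H

  JoinAdj : Fin m ⊎ Fin n → Fin m ⊎ Fin n → Set
  JoinAdj (inj₁ u) (inj₁ v) = G.Adj u v
  JoinAdj (inj₁ _) (inj₂ _) = Unit
  JoinAdj (inj₂ _) (inj₁ _) = Unit
  JoinAdj (inj₂ u) (inj₂ v) = H.Adj u v

  JoinAdj-symm : ∀ u v → JoinAdj u v → JoinAdj v u
  JoinAdj-symm (inj₁ _) (inj₁ _) e = G.symm e
  JoinAdj-symm (inj₁ _) (inj₂ _) _ = unit
  JoinAdj-symm (inj₂ _) (inj₁ _) _ = unit
  JoinAdj-symm (inj₂ _) (inj₂ _) e = H.symm e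

  JoinAdj-irrefl : ∀ v → ¬ JoinAdj v v
  JoinAdj-irrefl (inj₁ _) = G.irrefl
  JoinAdj-irrefl (inj₂ _) = H.irrefl

  -- In Fin (m + n) the first m vertices are those of G, the last n those of H.
  join : Graph (m + n)
  join = record
    { Adj    = λ u v → JoinAdj (splitAt m u) (splitAt m v)
    ; symm   = λ {u} {v} → JoinAdj-symm (splitAt m u) (splitAt m v)
    ; irrefl = λ {v} → JoinAdj-irrefl (splitAt m v)
    }

wheel : ∀ m n → Graph (m + n)
wheel m n = join (edgeless m) (cycle n)

module _ {k} (G : Graph k) where
  open Graph G

  data Walk : Fin k → Fin k → Set where
    nil  : ∀ {u} → Walk u u
    cons : ∀ {u v w} → Adj u v → Walk v w → Walk u w

  length : ∀ {u v} → Walk u v → ℕ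
  length nil        = 0
  length (cons _ p) = suc (length p)

  vertices : ∀ {u v} → Walk u v → List (Fin k)
  vertices (nil {u})      = u ∷ []
  vertices (cons {u} _ p) = u ∷ vertices p

  IsPath : ∀ {u v} → Walk u v → Set
  IsPath p = Unique (vertices p)

  IsShortestPath : ∀ {u v} → Walk u v → Set
  IsShortestPath {u} {v} p =
    IsPath p × (∀ (q : Walk u v) → IsPath q → length p ≤ length q)

  Convex : Subset k → Set
  Convex K = ∀ {u v} → u ∈ K → v ∈ K → (p : Walk u v) → IsShortestPath p →
             ∀ {w} → w ∈ˡ vertices p → w ∈ K

  -- H = [P]: H is the smallest convex set containing P.
  IsConvexHull : Subset k → Subset k → Set
  IsConvexHull P H =
    P ⊆ H × Convex H × (∀ K → Convex K → P ⊆ K → H ⊆ K)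

record Game : Set₁ where
  field
    Position : Set
    start    : Position
    _⟶_      : Position → Position → Set

IsMex : (ℕ → Set) → ℕ → Set
IsMex A k = ¬ A k × (∀ j → j < k → A j)

module _ (𝒢 : Game) where
  open Game 𝒢

  -- HasNim p k is the graph of the recursion nim(p) = mex{nim(q) : p ⟶ q};
  -- it is inductive, hence well-founded, and single-valued by nim-unique.
  data HasNim (p : Position) (k : ℕ) : Set where
    nim : (value : ∀ q → p ⟶ q → ℕ) →
          (∀ q (o : p ⟶ q) → HasNim q (value q o)) →
          IsMex (λ j → ∃ λ q → ∃ λ (o : p ⟶ q) → value q o ≡ j) k →
          HasNim p k

  nim-unique : ∀ {p j k} → HasNim p j → HasNim p k → j ≡ k
  nim-unique {_} {j} {k} (nim f hf (j∉ , below-j)) (nim g hg (k∉ , below-k))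
    with <-cmp j k
  ... | tri≈ _ j≡k _ = j≡k
  ... | tri< j<k _ _ = let (q , o , e) = below-k j j<k in
    contradiction (q , o , trans (nim-unique (hf q o) (hg q o)) e) j∉
  ... | tri> _ _ k<j = let (q , o , e) = below-j k k<j in
    contradiction (q , o , trans (sym (nim-unique (hf q o) (hg q o))) e) k∉

  GameHasNim : ℕ → Set
  GameHasNim = HasNim start

module _ {k} (G : Graph k) where

  Generating : Subset k → Set
  Generating P = IsConvexHull G P ⊤

  Move : Subset k → Subset k → Set
  Move P Q = Generating (∁ P) × ∃ λ v → v ∉ P × Q ≡ P ∪ ⁅ v ⁆

  -- The reachability proof is irrelevant, so positions with equal sets are equal.
  record Position : Set where
    constructor position
    field
      set        : Subset k
      .reachable : Star Move ⊥ set
  open Position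

  TER : Game
  TER = record
    { Position = Position
    ; start    = position ⊥ ε
    ; _⟶_      = λ P Q → Move (set P) (set Q)
    }

{-# OPTIONS --safe #-}
-- A set of vertices generates the wheel exactly when it is not a clique.  Once a
-- rim vertex is deleted, the rest of the rim consists of paths, and the position
-- only matters through the number a of hub vertices left, the number e of paths
-- with an odd number of vertices, and the size q of a maximum matching of the
-- paths: a move decreases a by 1, or e by 1, or replaces (q , e) by
-- (q − 1 , e + 1), and it is possible unless a ≤ 1 and q + e ≤ 1.  The nim-values
-- of this game with three parameters have a closed form.  The full rim has to be
-- treated separately only for odd n, as for n = 2k it behaves like q = k, e = 0.
module Submission where

open import Defs
open import Data.Nat using (ℕ; zero; suc; _+_; _*_; _∸_; _≤_; _<_; _≤?_; z≤n; s≤s; s≤s⁻¹)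
open import Data.Nat.Properties using
  ( +-comm; +-assoc; +-identityʳ; +-suc; +-monoʳ-≤; *-suc; m∸n+n≡m; suc-injective
  ; ≤-refl; ≤-reflexive; ≤-trans; ≤-<-trans; n≤1+n; 1+n≰n; m≤n+m; ≰⇒>; <⇒≤; ≤∧≢⇒<
  ; m<n⇒m<1+n; m≤n⇒m<n∨m≡n; m≤n⇒∃[o]m+o≡n )
open import Data.Nat.Divisibility using (_∣_; _∤_; divides; _∣0; ∣m∣n⇒∣m+n; ∣-refl)
open import Data.Nat.DivMod using
  (_%_; m%n<n; m<n⇒m%n≡m; n%n≡0; m%n%n≡m%n; [m+n]%n≡m%n; [m+kn]%n≡m%n; m*n%n≡0; %-distribˡ-+)
import Data.Integer.Properties as ℤ
import Algebra.Properties.AbelianGroup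
open import Data.Bool using (Bool; true; false)
open import Data.Bool.Properties using (∨-zeroʳ; ∨-identityʳ)
open import Data.Fin using (Fin; zero; suc; toℕ; fromℕ<; _↑ˡ_; _↑ʳ_; splitAt; _≟_)
open import Data.Fin.Properties as Fin using
  (toℕ<n; toℕ-fromℕ<; toℕ-injective; splitAt-↑ˡ; splitAt-↑ʳ; join-splitAt)
open import Data.Fin.Subset using (Subset; _∈_; _∉_; _∪_; ∁; ⁅_⁆; ⊤; ⊥; ∣_∣)
open import Data.Fin.Subset.Properties using
  (∈⊤; ∪-identityʳ; x∈∁p⇒x∉p; x∉p⇒x∈∁p; ∣∁p∣≡n∸∣p∣; ∣⊥∣≡0)
open import Data.List as List using (List; []; _∷_; map; applyUpTo)
open import Data.List.Properties using (length-applyUpTo; length-map)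
open import Data.List.Membership.Propositional using () renaming (_∈_ to _∈ˡ_)
open import Data.List.Membership.Propositional.Properties using (∈-applyUpTo⁺)
open import Data.List.Relation.Unary.Any using (here; there)
open import Data.List.Relation.Unary.All as All using (All; []; _∷_)
import Data.List.Relation.Unary.All.Properties as All
open import Data.List.Relation.Unary.AllPairs using ([]; _∷_)
open import Data.List.Relation.Unary.Unique.Propositional using (Unique)
import Data.List.Relation.Unary.Unique.Propositional.Properties as Unique
open import Data.Vec using ([]; _∷_; lookup; _[_]≔_; _++_)
open import Data.Vec.Properties using
  ( lookup∘update; lookup∘update′; lookup-++ˡ; lookup-++ʳ; lookup-replicate
  ; []≔-++-↑ˡ; []≔-++-↑ʳ; []=⇒lookup; lookup⇒[]= )
open import Data.Product using (∃; ∃₂; _×_; _,_; proj₁; proj₂)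
open import Data.Sum using (_⊎_; inj₁; inj₂)
open import Data.Sum.Properties using (inj₁-injective; inj₂-injective)
open import Data.Unit using (tt)
open import Function using (_∘_)
open import Relation.Nullary using (¬_; yes; no; contradiction)
open import Relation.Binary.Construct.Closure.ReflexiveTransitive using (ε; _◅_; _◅◅_)
open import Relation.Binary.PropositionalEquality using
  (_≡_; _≢_; refl; sym; trans; cong; cong₂; subst; module ≡-Reasoning)

-- Nim-values of the game with three parameters

-- Whichever vertex goes, a path with evenly many vertices leaves one even and one odd path; a path
-- with oddly many leaves two even or two odd ones. This is why a deletion changes `(q , e)` in only
-- two ways. Moreover `q + e` is the independence number of the paths, so the end of the game can be
-- read off. A whole rim of `2k` vertices can only become a path of `2k − 1`, which is the `pair`
-- move from `(k , 0)`; one of `2k + 1` can only become a path of `2k`, so unlike `(k , 1)` it has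
-- no `pair` move. Every move flips the parity of the number of vertices left, and within a region
-- of the parameters the values alternate with it. Neighbouring regions can have opposite phase; for
-- `a ≥ 1` the value 2 sits on the lines separating these, where options of value 0 and of value 1
-- both occur. One such line comes from comparing hub and rim: `a − (2q + e)` is the number of hub
-- vertices left minus the number of rim vertices left. At the start this is `m − n`, whence the
-- three ranges of `d`.

-- runs q a e: a hub vertices are left, and the parameters of the rim are q and e.
-- oddCycle k a: a hub vertices and a whole rim with 2k + 1 vertices are left.
data State : Set where
  runs     : (q a e : ℕ) → State
  oddCycle : (k a : ℕ) → State

Live : ℕ → ℕ → ℕ → Set
Live q a e = 2 ≤ a ⊎ 2 ≤ q + e

-- The moves on a whole odd rim carry no `Live` premise: the rims represented have at least five
-- vertices, two of which are always non-adjacent.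
data _↦_ : State → State → Set where
  hub      : ∀ {q a e} → Live q (suc a) e → runs q (suc a) e ↦ runs q a e
  lone     : ∀ {q a e} → Live q a (suc e) → runs q a (suc e) ↦ runs q a e
  pair     : ∀ {q a e} → Live (suc q) a e → runs (suc q) a e ↦ runs q a (suc e)
  hub-odd  : ∀ {k a} → oddCycle k (suc a) ↦ oddCycle k a
  cut-open : ∀ {k a} → oddCycle k a ↦ runs k a 0

-- The number of vertices left, which bounds the recursion in `hasNim-state`. The summand `a + 0`
-- copies the shape of `runs k a 0`, so that `cut-open` costs exactly one `suc` by computation.
size : State → ℕ
size (runs q a e)   = q * 2 + (a + e)
size (oddCycle k a) = suc (k * 2 + (a + 0))

↦-size : ∀ {s t} → s ↦ t → size s ≡ suc (size t)
↦-size (hub {q} {a} {e} _)  = +-suc (q * 2) (a + e)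
↦-size (lone {q} {a} {e} _) = trans (cong (q * 2 +_) (+-suc a e)) (+-suc (q * 2) (a + e))
↦-size (pair {q} {a} {e} _) =
  cong suc (sym (trans (cong (q * 2 +_) (+-suc a e)) (+-suc (q * 2) (a + e))))
↦-size (hub-odd {k} {a})    = cong suc (+-suc (k * 2) (a + 0))
↦-size cut-open             = refl

par : ℕ → ℕ
par 0             = 1
par 1             = 0
par (suc (suc n)) = par n

par≢2 : ∀ n → par n ≢ 2
par≢2 (suc (suc n)) = par≢2 n

par-suc-≢ : ∀ n → par (suc n) ≢ par n
par-suc-≢ 0 ()
par-suc-≢ 1 ()
par-suc-≢ (suc (suc n)) = par-suc-≢ n

<par⇒ : ∀ {j} n → j < par n → par (suc n) ≡ j × par n ≡ 1
<par⇒ 0 (s≤s z≤n)   = refl , refl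
<par⇒ (suc (suc n)) = <par⇒ n

par-lone : ∀ a e → par (suc (a + suc e)) ≡ par (a + e)
par-lone a e = cong (λ n → par (suc n)) (+-suc a e)

par-pair : ∀ a e → par (a + suc e) ≡ par (suc (a + e))
par-pair a e = cong par (+-suc a e)

par-even : ∀ q e → par (q * 2 + e + e) ≡ 1
par-even zero    zero    = refl
par-even zero    (suc e) = trans (par-lone e e) (par-even zero e)
par-even (suc q) e       = par-even q e

par-odd : ∀ q e → par (suc (q * 2 + e + e)) ≡ 0
par-odd zero    zero    = refl
par-odd zero    (suc e) = trans (par-pair e e) (par-odd zero e)
par-odd (suc q) e       = par-odd q e

par-*2+ : ∀ q n → par (q * 2 + n) ≡ par n
par-*2+ zero    n = refl
par-*2+ (suc q) n = par-*2+ q n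

par-suc-*2+ : ∀ q n → par (suc (q * 2 + n)) ≡ par (suc n)
par-suc-*2+ zero    n = refl
par-suc-*2+ (suc q) n = par-suc-*2+ q n

-- With D = a − e, the value of a state with a ≥ 1 that is not over depends on q
-- and D only.  For q ≥ 1 it alternates for D ≤ 0 and for D ≥ 2q, alternates with
-- the opposite phase for 2 ≤ D ≤ 2q − 2, and is 2 at D = 1 and D = 2q − 1; for
-- q = 0 it is 0 at D = 0, is 2 at D = ±1, and alternates elsewhere.
data Value : ℕ → ℕ → ℕ → ℕ → Set where
  over     : ∀ {q a e} → a ≤ 1 → q + e ≤ 1 → Value q a e 0
  none-0   : ∀ {q} → Value (2 + q) 0 0 0
  none-1   : ∀ {q} → Value (suc q) 0 1 2
  none-2   : ∀ {q e} → Value q 0 (2 + e) (par e)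
  few      : ∀ {q a e} → suc a ≤ e → Value (suc q) (suc a) e (par (suc a + e))
  ridge₁   : ∀ {q e} → Value (2 + q) (suc e) e 2
  between  : ∀ {q a e} → 2 + e ≤ a → 2 + a ≤ suc q * 2 + e →
             Value (suc q) a e (par (suc (a + e)))
  ridge₂   : ∀ {q a e} → 2 ≤ a → suc a ≡ suc q * 2 + e → Value (suc q) a e 2
  many     : ∀ {q a e} → suc q * 2 + e ≤ a → Value (suc q) a e (par (a + e))
  few-0    : ∀ {a e} → 3 + a ≤ e → Value 0 (suc a) e (par (suc a + e))
  ridge₁-0 : ∀ {a} → Value 0 (suc a) (2 + a) 2
  equal-0  : ∀ {a} → Value 0 (2 + a) (2 + a) 0
  ridge₂-0 : ∀ {a} → Value 0 (2 + a) (suc a) 2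
  many-0   : ∀ {a e} → 2 + e ≤ a → Value 0 a e (par (a + e))

data Valueˢ : State → ℕ → Set where
  runs    : ∀ {q a e v} → Value q a e v → Valueˢ (runs q a e) v
  below   : ∀ {k a} → a < (2 + k) * 2 → Valueˢ (oddCycle (2 + k) a) (par a)
  at      : ∀ {k a} → a ≡ (2 + k) * 2 → Valueˢ (oddCycle (2 + k) a) 2
  above   : ∀ {k a} → (2 + k) * 2 < a → Valueˢ (oddCycle (2 + k) a) (par (suc a))

Excluded : State → ℕ → Set
Excluded s v = ∃ λ w → Valueˢ s w × w ≢ v

record Mex (s : State) (v : ℕ) : Set where
  field
    excludes : ∀ {t} → s ↦ t → Excluded t v
    attains  : ∀ {j} → j < v → ∃ λ t → s ↦ t × Valueˢ t j
open Mex public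

excl : ∀ {q a e v w} → Value q a e w → w ≢ v → Excluded (runs q a e) v
excl V w≢v = _ , runs V , w≢v

Opp : State → ℕ → Set
Opp t n = Valueˢ t (par (suc n)) ⊎ Valueˢ t 2

Hit : State → ℕ → Set
Hit s n = ∃ λ t → s ↦ t × Valueˢ t (par (suc n))

-- An option of value 2 is harmless, since `par n` is at most 1. An option has to be exhibited only
-- if `par n` is 1, and the value 0 that it must have is then `par (suc n)`.
mex-par : ∀ {s v} n → v ≡ par n →
          (∀ {t} → s ↦ t → Opp t n) → (par n ≡ 1 → Hit s n) → Mex s v
mex-par {s} n refl opp hit .excludes step with opp step
... | inj₁ V = _ , V , par-suc-≢ n
... | inj₂ V = _ , V , λ e → par≢2 n (sym e)
mex-par n refl opp hit .attains j<v with <par⇒ n j<v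
... | refl , e = hit e

mex-2 : ∀ {s t₀ t₁} → (∀ {t} → s ↦ t → Valueˢ t 0 ⊎ Valueˢ t 1) →
        s ↦ t₀ → Valueˢ t₀ 0 → s ↦ t₁ → Valueˢ t₁ 1 → Mex s 2
mex-2 opp _ _ _ _ .excludes step with opp step
... | inj₁ V = _ , V , λ ()
... | inj₂ V = _ , V , λ ()
mex-2 _ s₀ V₀ _ _ .attains {0} _ = _ , s₀ , V₀
mex-2 _ _ _ s₁ V₁ .attains {1} _ = _ , s₁ , V₁
mex-2 _ _ _ _ _ .attains {suc (suc _)} (s≤s (s≤s ()))

mex-0 : ∀ {s} → (∀ {t} → s ↦ t → Excluded t 0) → Mex s 0
mex-0 opp .excludes = opp
mex-0 opp .attains ()

cast : ∀ {q a e v w} → v ≡ w → Value q a e v → Valueˢ (runs q a e) w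
cast refl V = runs V

not-live : ∀ q {a e} → a ≤ 1 → q + e ≤ 1 → Live q a e → ∀ {A : Set} → A
not-live _ a≤1 _ (inj₁ 2≤a) = contradiction (≤-trans 2≤a a≤1) 1+n≰n
not-live _ _ p≤1 (inj₂ 2≤p) = contradiction (≤-trans 2≤p p≤1) 1+n≰n

2≤₊ : ∀ {n} → 2 ≤ suc (suc n)
2≤₊ = s≤s (s≤s z≤n)

right : ∀ {q a n} → 2 ≤ n → 2 ≤ a ⊎ 2 ≤ q + n
right {q} {a} {n} h = inj₂ (≤-trans h (m≤n+m n q))

-- `hub` lowers D by one, `lone` raises D by one, and `pair` lowers both q and D by one. Each flips
-- the parity of `a + e`, which settles the moves inside the region; a move out of it ends on a line
-- of value 2, in a region of the same phase, or at the finished state with `q = a = 1`, whose value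
-- 0 fits.
few-opp : ∀ {q a e t} → suc a ≤ e → runs (suc q) (suc a) e ↦ t → Opp t (suc a + e)
few-opp {a = 0} {1} _ (hub _)           = inj₂ (runs none-1)
few-opp {a = 0} {suc (suc _)} _ (hub _) = inj₁ (runs none-2)
few-opp {a = suc _} l (hub _)           = inj₁ (runs (few (≤-trans (n≤1+n _) l)))
few-opp {q} {a} l (lone {e = e} _) with m≤n⇒m<n∨m≡n l
... | inj₁ (s≤s l′) = inj₁ (cast (sym (par-lone (suc a) e)) (few l′))
few-opp {0} _ (lone {e = 0} _)     | inj₂ refl = inj₁ (runs (over ≤-refl ≤-refl))
few-opp {0} _ (lone {e = suc _} _) | inj₂ refl = inj₂ (runs (ridge₂ 2≤₊ refl))
few-opp {suc _} _ (lone _)         | inj₂ refl = inj₂ (runs ridge₁)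
few-opp {suc _} {a} {e} l (pair _) = inj₁ (cast (par-pair (suc a) e) (few (≤-trans l (n≤1+n _))))
few-opp {0} {a} {e} l (pair _) with m≤n⇒m<n∨m≡n l
... | inj₁ l′   = inj₁ (cast (par-pair (suc a) e) (few-0 (s≤s l′)))
... | inj₂ refl = inj₂ (runs ridge₁-0)

few-hit : ∀ {q a e} → suc a ≤ e → Hit (runs (suc q) (suc a) e) (suc a + e)
few-hit {q} {0} {suc (suc _)} _ = _ , hub (right {suc q} 2≤₊) , runs none-2
few-hit {q} {suc _} l           = _ , hub (inj₁ 2≤₊) , runs (few (≤-trans (n≤1+n _) l))
-- With one hub vertex and `e = 1`, the `hub` move reaches `none-1` of value 2, so the witness has
-- to be a rim move.
few-hit {0} {0} {1} _           = _ , lone (inj₂ ≤-refl) , runs (over ≤-refl ≤-refl)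
few-hit {suc q} {0} {1} _       = _ , pair (inj₂ 2≤₊) , runs (few (s≤s z≤n))

ridge₁-opp : ∀ {q e t} → runs (2 + q) (suc e) e ↦ t → Valueˢ t 0 ⊎ Valueˢ t 1
ridge₁-opp {e = 0} (hub _)     = inj₁ (runs none-0)
ridge₁-opp {e = suc e} (hub _) = inj₂ (cast (par-even 0 (suc e)) (few ≤-refl))
ridge₁-opp {q} (lone {e = e} _) =
  inj₁ (cast (par-odd 0 e) (between ≤-refl (s≤s (s≤s (s≤s (s≤s (m≤n+m e (q * 2))))))))
ridge₁-opp {e = e} (pair _)    = inj₂ (cast (par-even 0 (suc e)) (few ≤-refl))

-- D = 1 lies between D = 0, where `few` gives 1, and D = 2, where `between` gives 0. For `e = 0` no
-- `lone` move leads up to D = 2, and taking the last hub vertex supplies the 0.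
ridge₁-mex : ∀ {q e} → Mex (runs (2 + q) (suc e) e) 2
ridge₁-mex {e = 0}     = mex-2 ridge₁-opp (hub (inj₂ 2≤₊)) (runs none-0) (pair (inj₂ 2≤₊)) (runs (few ≤-refl))
ridge₁-mex {q} {suc e} = mex-2 ridge₁-opp
  (lone (inj₁ 2≤₊)) (cast (par-odd 0 e) (between ≤-refl (s≤s (s≤s (s≤s (s≤s (m≤n+m e (q * 2))))))))
  (pair (inj₁ 2≤₊)) (cast (par-even 0 (2 + e)) (few ≤-refl))

between-opp : ∀ {q a e t} → 2 + e ≤ a → 2 + a ≤ suc q * 2 + e →
              runs (suc q) a e ↦ t → Opp t (suc (a + e))
-- With a single matched pair the range 2 ≤ D ≤ 2q - 2 is empty.
between-opp {0} l (s≤s (s≤s u)) _ = contradiction (≤-trans (n≤1+n _) (≤-trans l u)) 1+n≰n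
between-opp {suc q} l u (hub _) with m≤n⇒m<n∨m≡n l
... | inj₁ (s≤s l′) = inj₁ (runs (between l′ (≤-trans (n≤1+n _) u)))
... | inj₂ refl     = inj₂ (runs ridge₁)
between-opp {suc q} {a} l (s≤s (s≤s u)) (lone {e = e} _) with m≤n⇒m<n∨m≡n u
... | inj₁ u′ = inj₁ (cast (sym (par-pair a e))
                  (between (≤-trans (n≤1+n _) l)
                    (s≤s (s≤s (s≤s⁻¹ (≤-trans u′ (≤-reflexive (+-suc (suc q * 2) e))))))))
... | inj₂ u≡ = inj₂ (runs (ridge₂ (≤-trans 2≤₊ l) (cong suc (trans u≡ (+-suc (suc q * 2) e)))))
between-opp {suc q} {a} {e} l (s≤s (s≤s u)) (pair _) with m≤n⇒m<n∨m≡n l | m≤n⇒m<n∨m≡n u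
... | inj₁ l′ | inj₁ u′ = inj₁ (cast (cong (λ n → par (suc n)) (+-suc a e))
        (between l′ (s≤s (≤-trans u′ (≤-reflexive (sym (+-suc (suc (q * 2)) e)))))))
... | inj₁ l′ | inj₂ u≡ = inj₂ (runs (ridge₂ (≤-trans 2≤₊ l) (trans (cong suc u≡) (sym (+-suc (suc q * 2) e)))))
between-opp {suc 0} _ _ (pair _)       | inj₂ refl | _ = inj₂ (runs (ridge₂ 2≤₊ refl))
between-opp {suc (suc _)} _ _ (pair _) | inj₂ refl | _ = inj₂ (runs ridge₁)

between-hit : ∀ {q a e} → 2 + e ≤ a → 2 + a ≤ suc q * 2 + e → par (suc (a + e)) ≡ 1 →
              Hit (runs (suc q) a e) (suc (a + e))
between-hit {a = suc a} {e} l u p≡1 with m≤n⇒m<n∨m≡n l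
... | inj₁ (s≤s l′) = _ , hub (inj₁ (≤-trans 2≤₊ l)) , runs (between l′ (≤-trans (n≤1+n _) u))
-- At D = 2 the `hub` move would reach `ridge₁`, but then `a + e` is even and the value is 0, so
-- nothing has to be attained.
... | inj₂ refl     = contradiction (trans (sym p≡1) (par-odd 0 e)) λ ()

ridge₂-opp : ∀ {q e t} → 1 ≤ q * 2 + e → runs (suc q) (suc (q * 2 + e)) e ↦ t → Valueˢ t 0 ⊎ Valueˢ t 1
ridge₂-opp {0} {suc e} _ (hub _)  = inj₂ (cast (par-even 0 (suc e)) (few ≤-refl))
ridge₂-opp {suc q} {e} _ (hub _)  = inj₁ (cast (par-odd (suc q) e) (between (s≤s (s≤s (m≤n+m e (q * 2)))) ≤-refl))
ridge₂-opp {q} _ (lone {e = e} _) =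
  inj₂ (cast (trans (cong (λ n → par (suc (n + e))) (+-suc (q * 2) e)) (par-even q e))
    (many (s≤s (≤-reflexive (sym (+-suc (q * 2) e))))))
ridge₂-opp {0} {suc e} _ (pair _) = inj₁ (runs equal-0)
ridge₂-opp {suc q} {e} _ (pair _) =
  inj₂ (cast (trans (par-pair (suc (suc q * 2 + e)) e) (par-even (suc q) e))
    (many (s≤s (s≤s (≤-reflexive (+-suc (q * 2) e))))))

-- D = 2q - 1 lies between the last D of `between`, of value 0, and the first of `many`, of value 1.
-- The move `pair` reaches `many` as well, since D - 1 = 2(q - 1). With a single matched pair
-- `between` is empty: then `pair` gives the 0 through `equal-0` and `hub` gives the 1 through
-- `few`.
ridge₂-mex : ∀ {q e} → 1 ≤ q * 2 + e → Mex (runs (suc q) (suc (q * 2 + e)) e) 2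
ridge₂-mex {0} {suc e} l = mex-2 (ridge₂-opp {0} l) (pair (inj₁ 2≤₊)) (runs equal-0)
  (hub (inj₁ 2≤₊)) (cast (par-even 0 (suc e)) (few ≤-refl))
ridge₂-mex {suc q} {e} l = mex-2 (ridge₂-opp {suc q} l)
  (hub (inj₁ 2≤₊)) (cast (par-odd (suc q) e) (between (s≤s (s≤s (m≤n+m e (q * 2)))) ≤-refl))
  (pair (inj₁ 2≤₊)) (cast (trans (par-pair (suc (suc q * 2 + e)) e) (par-even (suc q) e))
    (many (s≤s (s≤s (≤-reflexive (+-suc (q * 2) e))))))

many-opp : ∀ {q a e t} → suc q * 2 + e ≤ a → runs (suc q) a e ↦ t → Opp t (a + e)
many-opp {q} {e = e} l (hub _) with m≤n⇒m<n∨m≡n l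
... | inj₁ (s≤s l′) = inj₁ (runs (many l′))
many-opp {0} {e = 0} _ (hub _)     | inj₂ refl = inj₁ (runs (over ≤-refl ≤-refl))
many-opp {0} {e = suc _} _ (hub _) | inj₂ refl = inj₂ (runs (ridge₂ 2≤₊ refl))
many-opp {suc _} _ (hub _)         | inj₂ refl = inj₂ (runs (ridge₂ 2≤₊ refl))
many-opp {q} {a} l (lone {e = e} _) =
  inj₁ (cast (sym (par-lone a e)) (many (≤-trans (s≤s (s≤s (+-monoʳ-≤ (q * 2) (n≤1+n e)))) l)))
many-opp {suc q} {a} {e} l (pair _) =
  inj₁ (cast (par-pair a e) (many (≤-trans (s≤s (s≤s (≤-trans (≤-reflexive (+-suc (q * 2) e)) (n≤1+n _)))) l)))
many-opp {0} {a} {e} l (pair _) with m≤n⇒m<n∨m≡n l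
... | inj₁ l′   = inj₁ (cast (par-pair a e) (many-0 l′))
... | inj₂ refl = inj₂ (runs ridge₂-0)

-- Rim moves increase the surplus of hub vertices and so stay away from `ridge₂`. With a single
-- matched pair, however, `pair` may land on `ridge₂-0`; `lone` replaces it, and `hub` if `e = 0`.
many-hit : ∀ {q a e} → suc q * 2 + e ≤ a → Hit (runs (suc q) a e) (a + e)
many-hit {suc q} {a} {e} l = _ , pair (inj₁ (≤-trans 2≤₊ l)) ,
  cast (par-pair a e) (many (≤-trans (s≤s (s≤s (≤-trans (≤-reflexive (+-suc (q * 2) e)) (n≤1+n _)))) l))
many-hit {0} {a} {suc e} l = _ , lone (inj₁ (≤-trans 2≤₊ l)) , cast (sym (par-lone a e)) (many (≤-trans (n≤1+n _) l))
many-hit {0} {suc a} {0} l with m≤n⇒m<n∨m≡n l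
... | inj₁ (s≤s l′) = _ , hub (inj₁ l) , runs (many l′)
... | inj₂ refl     = _ , hub (inj₁ l) , runs (over ≤-refl ≤-refl)

-- With `q = 0` only `hub` and `lone` remain, and the game is symmetric in `a` and `e`: either drops
-- by one until both are at most 1. The lemmas on `many-0` are the mirror image.
few-0-opp : ∀ {a e t} → 3 + a ≤ e → runs 0 (suc a) e ↦ t → Opp t (suc a + e)
few-0-opp {0} (s≤s (s≤s _)) (hub _) = inj₁ (runs none-2)
few-0-opp {suc _} l (hub _)         = inj₁ (runs (few-0 (≤-trans (n≤1+n _) l)))
few-0-opp {a} l (lone {e = e} _) with m≤n⇒m<n∨m≡n l
... | inj₁ (s≤s l′) = inj₁ (cast (sym (par-lone (suc a) e)) (few-0 l′))
... | inj₂ refl     = inj₂ (runs ridge₁-0)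

few-0-hit : ∀ {a e} → 3 + a ≤ e → Hit (runs 0 (suc a) e) (suc a + e)
few-0-hit {0} (s≤s (s≤s _)) = _ , hub (inj₂ 2≤₊) , runs none-2
few-0-hit {suc _} l         = _ , hub (inj₁ 2≤₊) , runs (few-0 (≤-trans (n≤1+n _) l))

ridge₁-0-hub : ∀ a → Valueˢ (runs 0 a (2 + a)) 1
ridge₁-0-hub 0       = runs none-2
ridge₁-0-hub (suc a) = cast (trans (cong (λ n → par (suc n)) (+-comm a (3 + a))) (par-even 0 a)) (few-0 ≤-refl)

equal-0′ : ∀ a → Valueˢ (runs 0 (suc a) (suc a)) 0
equal-0′ 0       = runs (over ≤-refl ≤-refl)
equal-0′ (suc a) = runs equal-0

many-0-opp : ∀ {a e t} → 2 + e ≤ a → runs 0 a e ↦ t → Opp t (a + e)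
many-0-opp {e = e} l (hub _) with m≤n⇒m<n∨m≡n l
... | inj₁ (s≤s l′) = inj₁ (runs (many-0 l′))
many-0-opp {e = 0} _ (hub _)     | inj₂ refl = inj₁ (runs (over ≤-refl z≤n))
many-0-opp {e = suc _} _ (hub _) | inj₂ refl = inj₂ (runs ridge₂-0)
many-0-opp {a} l (lone {e = e} _) = inj₁ (cast (sym (par-lone a e)) (many-0 (≤-trans (n≤1+n _) l)))

many-0-hit : ∀ {a e} → 2 + e ≤ a → Hit (runs 0 a e) (a + e)
many-0-hit {a} {suc e} l = _ , lone (inj₁ (≤-trans 2≤₊ l)) , cast (sym (par-lone a e)) (many-0 (≤-trans (n≤1+n _) l))
many-0-hit {suc a} {0} l with m≤n⇒m<n∨m≡n l
... | inj₁ (s≤s l′) = _ , hub (inj₁ l) , runs (many-0 l′)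
... | inj₂ refl     = _ , hub (inj₁ l) , runs (over ≤-refl z≤n)

none-2-opp : ∀ {q e t} → runs q 0 (2 + e) ↦ t → Opp t e
none-2-opp {0} {0} (lone _)     = inj₁ (runs (over z≤n ≤-refl))
none-2-opp {suc _} {0} (lone _) = inj₂ (runs none-1)
none-2-opp {e = suc _} (lone _) = inj₁ (runs none-2)
none-2-opp (pair _)             = inj₁ (runs none-2)

none-2-hit : ∀ {q e} → Hit (runs q 0 (2 + e)) e
none-2-hit {0} {0}         = _ , lone (inj₂ 2≤₊) , runs (over z≤n ≤-refl)
none-2-hit {suc q} {0}     = _ , pair (right {suc q} 2≤₊) , runs none-2
none-2-hit {q} {suc _}     = _ , lone (right {q} 2≤₊) , runs none-2

none-1-lone : ∀ q → Valueˢ (runs (suc q) 0 0) 0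
none-1-lone 0       = runs (over z≤n ≤-refl)
none-1-lone (suc _) = runs none-0

value-mex : ∀ {q a e v} → Value q a e v → Mex (runs q a e) v
value-mex (over {q} a≤1 p≤1) = mex-0 λ
  { (hub l) → not-live q a≤1 p≤1 l ; (lone l) → not-live q a≤1 p≤1 l ; (pair l) → not-live q a≤1 p≤1 l }
value-mex none-0 = mex-0 λ { (pair _) → excl none-1 λ () }
value-mex (none-1 {q}) = mex-2
  (λ { (lone _) → inj₁ (none-1-lone q) ; (pair _) → inj₂ (runs none-2) })
  (lone live) (none-1-lone q) (pair live) (runs none-2)
  where
  live : 2 ≤ 0 ⊎ 2 ≤ suc q + 1
  live = inj₂ (s≤s (m≤n+m 1 q))
value-mex (none-2 {q} {e}) = mex-par e refl none-2-opp λ _ → none-2-hit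
value-mex (few {a = a} {e} l) = mex-par (suc a + e) refl (few-opp l) λ _ → few-hit l
value-mex ridge₁ = ridge₁-mex
value-mex (between {a = a} {e} l u) = mex-par (suc (a + e)) refl (between-opp l u) (between-hit l u)
value-mex (ridge₂ {q} (s≤s l) refl) = ridge₂-mex {q} l
value-mex (many {a = a} {e} l) = mex-par (a + e) refl (many-opp l) λ _ → many-hit l
value-mex (few-0 {a} {e} l) = mex-par (suc a + e) refl (few-0-opp l) λ _ → few-0-hit l
value-mex (ridge₁-0 {a}) = mex-2
  (λ { (hub _) → inj₂ (ridge₁-0-hub a) ; (lone _) → inj₁ (equal-0′ a) })
  (lone (inj₂ 2≤₊)) (equal-0′ a) (hub (inj₂ 2≤₊)) (ridge₁-0-hub a)
value-mex equal-0 = mex-0 λ { (hub _) → excl ridge₁-0 λ () ; (lone _) → excl ridge₂-0 λ () }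
value-mex (ridge₂-0 {a}) = mex-2
  (λ { (hub _) → inj₁ (equal-0′ a) ; (lone _) → inj₂ (cast (par-even 0 a) (many-0 ≤-refl)) })
  (hub (inj₁ 2≤₊)) (equal-0′ a) (lone (inj₁ 2≤₊)) (cast (par-even 0 a) (many-0 ≤-refl))
value-mex (many-0 {a} {e} l) = mex-par (a + e) refl (many-0-opp l) λ _ → many-0-hit l

-- Cutting the rim open gives a state with D = a. As `a` grows it runs through `none-0`, `ridge₁`,
-- `between` and `ridge₂`, all of which have the opposite phase or the value 2.
below-opp : ∀ {k a t} → a < (2 + k) * 2 → oddCycle (2 + k) a ↦ t → Opp t a
below-opp l hub-odd = inj₁ (below (≤-trans (n≤1+n _) l))
below-opp {a = 0} _ cut-open = inj₁ (runs none-0)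
below-opp {a = 1} _ cut-open = inj₂ (runs ridge₁)
below-opp {k} {suc (suc a)} l cut-open with m≤n⇒m<n∨m≡n l
... | inj₁ l′ = inj₁ (cast (cong (λ n → par (suc n)) (+-identityʳ a))
                  (between 2≤₊ (≤-trans l′ (≤-reflexive (sym (+-identityʳ _))))))
... | inj₂ l≡ = inj₂ (runs (ridge₂ 2≤₊ (trans l≡ (sym (+-identityʳ _)))))

below-hit : ∀ {k a} → a < (2 + k) * 2 → Hit (oddCycle (2 + k) a) a
below-hit {a = 0} _     = _ , cut-open , runs none-0
below-hit {a = suc _} l = _ , hub-odd , below (≤-trans (n≤1+n _) l)

above-opp : ∀ {k a t} → (2 + k) * 2 < a → oddCycle (2 + k) a ↦ t → Opp t (suc a)
above-opp l hub-odd with m≤n⇒m<n∨m≡n l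
... | inj₁ (s≤s l′) = inj₁ (above l′)
... | inj₂ l≡       = inj₂ (at (suc-injective (sym l≡)))
above-opp {k} {a} l cut-open = inj₁ (cast (cong par (+-identityʳ a))
  (many (≤-trans (≤-reflexive (+-identityʳ _)) (≤-trans (n≤1+n _) l))))

many-at : ∀ k → Valueˢ (runs (2 + k) ((2 + k) * 2) 0) 1
many-at k = cast (trans (cong (λ n → par (n + 0)) (sym (+-identityʳ (k * 2)))) (par-even k 0))
  (many (≤-reflexive (+-identityʳ _)))

below-at : ∀ k → Valueˢ (oddCycle (2 + k) (3 + k * 2)) 0
below-at k = subst (Valueˢ _) (trans (cong (λ n → par (suc n)) (sym eq)) (par-odd k 0)) (below ≤-refl)
  where
  eq : k * 2 + 0 + 0 ≡ k * 2
  eq = trans (+-identityʳ (k * 2 + 0)) (+-identityʳ (k * 2))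

valueˢ-mex : ∀ {s v} → Valueˢ s v → Mex s v
valueˢ-mex (runs V)          = value-mex V
valueˢ-mex (below {a = a} l) = mex-par a refl (below-opp l) λ _ → below-hit l
valueˢ-mex (at {k} refl)     = mex-2
  (λ { hub-odd → inj₁ (below-at k) ; cut-open → inj₂ (many-at k) })
  hub-odd (below-at k) cut-open (many-at k)
valueˢ-mex (above {k} {a} l) = mex-par (suc a) refl (above-opp l)
  λ _ → _ , cut-open , cast (cong par (+-identityʳ a))
    (many (≤-trans (≤-reflexive (+-identityʳ _)) (≤-trans (n≤1+n _) l)))

-- Nim-values from a consistent assignment of values to positions

module _ (𝒢 : Game) where
  open Game 𝒢 hiding (Position)

  -- T N p v: p is assigned the value v, with N moves left at most.
  module _ (T : ℕ → Game.Position 𝒢 → ℕ → Set)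
           (excludes : ∀ {N p v q} → T N p v → p ⟶ q →
                       ∃₂ λ M w → N ≡ suc M × T M q w × w ≢ v)
           (attains  : ∀ {N p v j} → T N p v → j < v →
                       ∃₂ λ M q → N ≡ suc M × p ⟶ q × T M q j) where

    -- The value function on the options is read off from `excludes`, whereas `attains` produces its
    -- own assignment for the option that it finds; `nim-unique` identifies the two values.
    hasNim : ∀ N {p v} → T N p v → HasNim 𝒢 p v
    hasNim N {p} {v} t = nim (λ _ o → proj₁ (proj₂ (excludes t o))) (values N t)
      ( (λ (_ , o , w≡v) → proj₂ (proj₂ (proj₂ (proj₂ (excludes t o)))) w≡v)
      , attained N t )
      where
      values : ∀ N (t : T N p v) q (o : p ⟶ q) → HasNim 𝒢 q (proj₁ (proj₂ (excludes t o)))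
      values N t q o with excludes t o
      ... | M , w , refl , t′ , _ = hasNim M t′

      attained : ∀ N (t : T N p v) j → j < v →
                 ∃ λ q → ∃ λ (o : p ⟶ q) → proj₁ (proj₂ (excludes t o)) ≡ j
      attained N t j j<v with attains t j<v
      ... | M , q , refl , o , t′ = q , o , nim-unique 𝒢 (values (suc M) t q o) (hasNim M t′)

-- Convex hulls of cliques and of non-adjacent pairs

module _ {k} (G : Graph k) where
  open Graph G

  IsClique : Subset k → Set
  IsClique S = ∀ {u v} → u ∈ S → v ∈ S → u ≡ v ⊎ Adj u v

  -- Two vertices of a clique have distance at most 1, so a shortest path between them has no inner
  -- vertex.
  clique-convex : ∀ {S} → IsClique S → Convex G S
  clique-convex clique u∈S v∈S nil _ (here refl) = u∈S
  clique-convex clique u∈S v∈S (cons e p) (_ , min) w∈p with clique u∈S v∈S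
  ... | inj₁ refl = contradiction (min nil ([] ∷ [])) λ ()
  ... | inj₂ e′ with p | min (cons e′ nil) (((λ { refl → irrefl e′ }) ∷ []) ∷ [] ∷ []) | w∈p
  ...   | nil | _ | here refl         = u∈S
  ...   | nil | _ | there (here refl) = v∈S
  ...   | cons _ _ | s≤s () | _

  clique-generating : ∀ {S} → IsClique S → Generating G S → ∀ v → v ∈ S
  clique-generating clique (_ , _ , min) v = min _ (clique-convex clique) (λ w∈S → w∈S) ∈⊤

  convex-common : ∀ {K u v w} → Convex G K → u ∈ K → v ∈ K → u ≢ v → ¬ Adj u v →
                  Adj u w → Adj w v → w ∈ K
  convex-common {u = u} {v} {w} convex u∈K v∈K u≢v ¬uv uw wv =
    convex u∈K v∈K (cons uw (cons wv nil)) (path , min) (there (here refl))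
    where
    path : Unique (u ∷ w ∷ v ∷ [])
    path = ((λ { refl → irrefl uw }) ∷ u≢v ∷ []) ∷ ((λ { refl → irrefl wv }) ∷ []) ∷ [] ∷ []

    min : ∀ (q : Walk G u v) → IsPath G q → 2 ≤ length G q
    min nil _                   = contradiction refl u≢v
    min (cons e nil) _          = contradiction e ¬uv
    min (cons _ (cons _ _)) _   = s≤s (s≤s z≤n)

-- Deleting a vertex from a union of paths

-- Entry true means deleted.  Runs l q e: e of the maximal runs of vertices left in
-- l have odd length, and a maximum matching of all the runs has q edges.
data Runs : List Bool → ℕ → ℕ → Set where
  []   : Runs [] 0 0
  gap  : ∀ {l q e} → Runs l q e → Runs (true ∷ l) q e
  pair : ∀ {l q e} → Runs l q e → Runs (false ∷ false ∷ l) (suc q) e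
  last : Runs (false ∷ []) 0 1
  lone : ∀ {l q e} → Runs l q e → Runs (false ∷ true ∷ l) q (suc e)

data Delete : List Bool → List Bool → Set where
  here  : ∀ {l} → Delete (false ∷ l) (true ∷ l)
  there : ∀ {b l l′} → Delete l l′ → Delete (b ∷ l) (b ∷ l′)

-- The new vertex switches the parity of the first run: an even run, possibly empty, becomes odd,
-- and an odd one gets its unpaired vertex matched.
grow : ∀ {l q e} → Runs l q e →
       Runs (false ∷ l) q (suc e) ⊎ ∃ λ e′ → e ≡ suc e′ × Runs (false ∷ l) (suc q) e′
grow []       = inj₁ last
grow (gap r)  = inj₁ (lone r)
grow last     = inj₂ (_ , refl , pair [])
grow (lone r) = inj₂ (_ , refl , pair (gap r))
grow (pair r) with grow r
... | inj₁ r′              = inj₁ (pair r′)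
... | inj₂ (_ , refl , r′) = inj₂ (_ , refl , pair r′)

Deleted : List Bool → ℕ → ℕ → Set
Deleted l q e = (∃ λ e′ → e ≡ suc e′ × Runs l q e′) ⊎ (∃ λ q′ → q ≡ suc q′ × Runs l q′ (suc e))

-- Vertices are matched from the left. Deleting the second vertex of a pair leaves the first one
-- alone; deleting the first shifts the matching along the rest of the run, which is what `grow`
-- describes.
delete : ∀ {l l′ q e} → Runs l q e → Delete l l′ → Deleted l′ q e
delete (gap r) (there d) with delete r d
... | inj₁ (_ , eq , r′) = inj₁ (_ , eq , gap r′)
... | inj₂ (_ , eq , r′) = inj₂ (_ , eq , gap r′)
delete (pair r) here with grow r
... | inj₁ r′             = inj₂ (_ , refl , gap r′)
... | inj₂ (_ , eq , r′)  = inj₁ (_ , eq , gap r′)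
delete (pair r) (there here) = inj₂ (_ , refl , lone r)
delete (pair r) (there (there d)) with delete r d
... | inj₁ (_ , eq , r′)   = inj₁ (_ , eq , pair r′)
... | inj₂ (_ , refl , r′) = inj₂ (_ , refl , pair r′)
delete last here     = inj₁ (_ , refl , gap [])
delete (lone r) here = inj₁ (_ , refl , gap (gap r))
delete (lone r) (there (there d)) with delete r d
... | inj₁ (_ , refl , r′) = inj₁ (_ , refl , lone r′)
... | inj₂ (_ , refl , r′) = inj₂ (_ , refl , lone r′)

delete-lone : ∀ {l q e} → Runs l q (suc e) → ∃ λ l′ → Delete l l′ × Runs l′ q e
delete-lone (gap r)  = let (_ , d , r′) = delete-lone r in _ , there d , gap r′
delete-lone (pair r) = let (_ , d , r′) = delete-lone r in _ , there (there d) , pair r′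
delete-lone last     = _ , here , gap []
delete-lone (lone r) = _ , here , gap (gap r)

delete-pair : ∀ {l q e} → Runs l (suc q) e → ∃ λ l′ → Delete l l′ × Runs l′ q (suc e)
delete-pair (gap r)  = let (_ , d , r′) = delete-pair r in _ , there d , gap r′
delete-pair (pair r) = _ , there here , lone r
delete-pair (lone r) = let (_ , d , r′) = delete-pair r in _ , there (there d) , lone r′

-- Deletions in a subset and in a list of its vertices

module _ {n} (c : Subset n) where

  private
    variable
      v : Fin n
      vs : List (Fin n)

  map-update-∉ : All (v ≢_) vs → map (lookup (c [ v ]≔ true)) vs ≡ map (lookup c) vs
  map-update-∉ [] = refl
  map-update-∉ (v≢w ∷ v∉) = cong₂ _∷_ (lookup∘update′ (v≢w ∘ sym) c true) (map-update-∉ v∉)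

  update-Delete : Unique vs → v ∈ˡ vs → lookup c v ≡ false →
                  Delete (map (lookup c) vs) (map (lookup (c [ v ]≔ true)) vs)
  update-Delete {v = v} (v∉ ∷ _) (here refl) v≡ rewrite map-update-∉ v∉ | v≡ | lookup∘update v c true = here
  update-Delete {v = v} (w∉ ∷ u) (there v∈) v≡
    rewrite lookup∘update′ (All.lookup w∉ v∈) c true = there (update-Delete u v∈ v≡)

  Delete-update : ∀ vs {l} → Unique vs → Delete (map (lookup c) vs) l →
                  ∃ λ v → v ∈ˡ vs × lookup c v ≡ false × l ≡ map (lookup (c [ v ]≔ true)) vs
  Delete-update (v ∷ vs) (v∉ ∷ u) d with lookup c v in v≡
  Delete-update (v ∷ vs) (v∉ ∷ u) here | false =
    v , here refl , v≡ , sym (cong₂ _∷_ (lookup∘update v c true) (map-update-∉ v∉))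
  Delete-update (v ∷ vs) (v∉ ∷ u) (there d) | _ with Delete-update vs u d
  ... | w , w∈ , w≡ , eq = w , there w∈ , w≡ ,
    cong₂ _∷_ (trans (sym v≡) (sym (lookup∘update′ (All.lookup v∉ w∈) c true))) eq

-- Adjacency among the vertices left on an induced path

module _ {n} (G : Graph n) where
  open Graph G

  data InducedPath : List (Fin n) → Set where
    []     : InducedPath []
    single : ∀ {v} → InducedPath (v ∷ [])
    extend : ∀ {u v vs} → Adj u v → All (λ w → ¬ Adj u w) vs → InducedPath (v ∷ vs) →
             InducedPath (u ∷ v ∷ vs)

  module _ (c : Subset n) where

    some : ∀ vs {q e} → Runs (map (lookup c) vs) q e → 1 ≤ q + e →
           ∃ λ v → v ∈ˡ vs × lookup c v ≡ false
    some [] [] ()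
    some (v ∷ vs) r 1≤ with lookup c v in v≡
    ... | false = v , here refl , v≡
    some (v ∷ vs) (gap r) 1≤ | true = let (w , w∈ , w≡) = some vs r 1≤ in w , there w∈ , w≡

    -- The first vertex left is adjacent to nothing beyond its successor in the list, and these two
    -- entries account for only 1 of `q + e`. Any vertex left beyond them will do.
    nonadjacent : ∀ vs {q e} → Unique vs → InducedPath vs → Runs (map (lookup c) vs) q e → 2 ≤ q + e →
                  ∃₂ λ u v → u ≢ v × ¬ Adj u v × lookup c u ≡ false × lookup c v ≡ false
    nonadjacent [] _ _ [] ()
    nonadjacent (v ∷ vs) uq ind r 2≤ with lookup c v in v≡
    nonadjacent (v ∷ []) uq ind (gap r) 2≤ | true = nonadjacent [] [] [] r 2≤
    nonadjacent (v ∷ vs@(_ ∷ _)) (_ ∷ uq) (extend _ _ ind) (gap r) 2≤ | true = nonadjacent vs uq ind r 2≤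
    nonadjacent (v ∷ []) uq ind last (s≤s ()) | false
    nonadjacent (v ∷ w ∷ vs) uq ind r 2≤ | false with lookup c w
    nonadjacent (v ∷ w ∷ vs) ((_ ∷ v∉) ∷ _) (extend _ ¬adj _) (pair r) (s≤s 1≤) | false | false =
      let (x , x∈ , x≡) = some vs r 1≤ in v , x , All.lookup v∉ x∈ , All.lookup ¬adj x∈ , v≡ , x≡
    nonadjacent (v ∷ w ∷ vs) ((_ ∷ v∉) ∷ _) (extend _ ¬adj _) (lone {q = q} {e} r) 2≤ | false | true =
      let (x , x∈ , x≡) = some vs r (drop1 q e 2≤) in v , x , All.lookup v∉ x∈ , All.lookup ¬adj x∈ , v≡ , x≡
      where
      drop1 : ∀ q e → 2 ≤ q + suc e → 1 ≤ q + e
      drop1 zero (suc _) _ = s≤s z≤n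
      drop1 (suc _) _ _    = s≤s z≤n
      drop1 zero zero (s≤s ())

    none : ∀ vs → Runs (map (lookup c) vs) 0 0 → ∀ {v} → v ∈ˡ vs → lookup c v ≢ false
    none (w ∷ vs) r v∈ v≡ with lookup c w in w≡
    none (w ∷ vs) (gap r) (here refl) v≡ | true = contradiction (trans (sym w≡) v≡) λ ()
    none (w ∷ vs) (gap r) (there v∈) v≡ | true = none vs r v∈ v≡

    -- The leading entry, together with `x`, already uses up `q + e ≤ 1`, whether `x` is deleted or
    -- not.
    none-rest : ∀ x vs {q e} → Runs (false ∷ map (lookup c) (x ∷ vs)) q e → q + e ≤ 1 →
                ∀ {v} → v ∈ˡ vs → lookup c v ≢ false
    none-rest x vs r ≤1 with lookup c x
    none-rest x vs (pair {q = 0} {0} r) ≤1 | false = none vs r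
    none-rest x vs (pair {q = 0} {suc _} r) (s≤s ()) | false
    none-rest x vs (pair {q = suc _} r) (s≤s ()) | false
    none-rest x vs (lone {q = 0} {0} r) ≤1 | true  = none vs r
    none-rest x vs (lone {q = 0} {suc _} r) (s≤s ()) | true
    none-rest x vs (lone {q = suc q} {e} r) (s≤s ≤0) | true =
      contradiction (≤-trans (m≤n+m (suc e) q) ≤0) λ ()

    adjacent : ∀ vs {q e} → InducedPath vs → Runs (map (lookup c) vs) q e → q + e ≤ 1 →
               ∀ {u v} → u ∈ˡ vs → v ∈ˡ vs → lookup c u ≡ false → lookup c v ≡ false → u ≡ v ⊎ Adj u v
    adjacent (w ∷ []) _ _ _ (here refl) (here refl) _ _ = inj₁ refl
    adjacent (w ∷ x ∷ vs) ind r ≤1 u∈ v∈ u≡ v≡ with lookup c w in w≡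
    adjacent (w ∷ x ∷ vs) (extend _ _ ind) (gap r) ≤1 (there u∈) (there v∈) u≡ v≡ | true =
      adjacent (x ∷ vs) ind r ≤1 u∈ v∈ u≡ v≡
    adjacent (w ∷ x ∷ vs) _ (gap r) ≤1 (here refl) _ u≡ v≡ | true = contradiction (trans (sym w≡) u≡) λ ()
    adjacent (w ∷ x ∷ vs) _ (gap r) ≤1 _ (here refl) u≡ v≡ | true = contradiction (trans (sym w≡) v≡) λ ()
    adjacent (w ∷ x ∷ vs) _ r ≤1 (here refl) (here refl) _ _ | false = inj₁ refl
    adjacent (w ∷ x ∷ vs) (extend wx _ _) r ≤1 (here refl) (there (here refl)) _ _ | false = inj₂ wx
    adjacent (w ∷ x ∷ vs) (extend wx _ _) r ≤1 (there (here refl)) (here refl) _ _ | false = inj₂ (symm wx)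
    adjacent (w ∷ x ∷ vs) _ r ≤1 (there (here refl)) (there (here refl)) _ _ | false = inj₁ refl
    adjacent (w ∷ x ∷ vs) _ r ≤1 (there (there u∈)) _ u≡ _ | false = contradiction u≡ (none-rest x vs r ≤1 u∈)
    adjacent (w ∷ x ∷ vs) _ r ≤1 _ (there (there v∈)) _ v≡ | false = contradiction v≡ (none-rest x vs r ≤1 v∈)

InducedPath-applyUpTo : ∀ {n} (G : Graph n) (f : ℕ → Fin n) k →
                    (∀ i → suc i < k → Graph.Adj G (f i) (f (suc i))) →
                    (∀ i j → suc i < j → j < k → ¬ Graph.Adj G (f i) (f j)) →
                    InducedPath G (applyUpTo f k)
InducedPath-applyUpTo G f zero _ _ = []
InducedPath-applyUpTo G f (suc zero) _ _ = single
InducedPath-applyUpTo G f (suc (suc k)) adj ¬adj =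
  extend (adj 0 (s≤s (s≤s z≤n)))
         (All.applyUpTo⁺₁ _ k λ i<k → ¬adj 0 _ (s≤s (s≤s z≤n)) (s≤s (s≤s i<k)))
         (InducedPath-applyUpTo G (f ∘ suc) (suc k) (λ i l → adj (suc i) (s≤s l))
           (λ i j l u → ¬adj (suc i) (suc j) (s≤s l) (s≤s u)))

-- The cycle cut open at a vertex

module _ {N : ℕ} where

  private
    n = suc N

  %-cong-+ : ∀ x y z → x % n ≡ y % n → (x + z) % n ≡ (y + z) % n
  %-cong-+ x y z eq = trans (%-distribˡ-+ x z n)
    (trans (cong (λ r → (r + z % n) % n) eq) (sym (%-distribˡ-+ y z n)))

  %-suc : ∀ x → suc (x % n) % n ≡ suc x % n
  %-suc x = trans (cong (_% n) (+-comm 1 (x % n)))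
    (trans (%-cong-+ (x % n) x 1 (m%n%n≡m%n x n)) (cong (_% n) (+-comm x 1)))

  -- To cancel `x` without subtraction, `x * N` is added on both sides: it is the negative of `x`
  -- modulo `n = suc N`.
  %-shift-≢ : ∀ x k → suc k < n → x % n ≢ (x + suc k) % n
  %-shift-≢ x k k<n eq = contradiction (trans (sym (m<n⇒m%n≡m k<n)) k%n≡0) λ ()
    where
    open ≡-Reasoning
    k%n≡0 : suc k % n ≡ 0
    k%n≡0 = begin
      suc k % n                 ≡⟨ [m+kn]%n≡m%n (suc k) x n ⟨
      (suc k + x * n) % n       ≡⟨ cong (λ y → (suc k + y) % n) (*-suc x N) ⟩
      (suc k + (x + x * N)) % n ≡⟨ cong (_% n) (+-assoc (suc k) x (x * N)) ⟨
      (suc k + x + x * N) % n   ≡⟨ cong (λ y → (y + x * N) % n) (+-comm (suc k) x) ⟩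
      (x + suc k + x * N) % n   ≡⟨ %-cong-+ x (x + suc k) (x * N) eq ⟨
      (x + x * N) % n           ≡⟨ cong (_% n) (*-suc x N) ⟨
      (x * n) % n               ≡⟨ m*n%n≡0 x n ⟩
      0                         ∎

  Next⇒% : ∀ {u v : Fin n} → Next u v → toℕ v ≡ suc (toℕ u) % n
  Next⇒% {v = v} (inj₁ eq)     = trans eq (sym (m<n⇒m%n≡m (subst (_< n) eq (toℕ<n v))))
  Next⇒% (inj₂ (u≡ , v≡)) = trans v≡ (sym (trans (cong (_% n) u≡) (n%n≡0 n)))

  %⇒Next : ∀ {u v : Fin n} → toℕ v ≡ suc (toℕ u) % n → Next u v
  %⇒Next {u} eq with m≤n⇒m<n∨m≡n (toℕ<n u)
  ... | inj₁ l  = inj₁ (trans eq (m<n⇒m%n≡m l))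
  ... | inj₂ u≡ = inj₂ (u≡ , trans eq (trans (cong (_% n) u≡) (n%n≡0 n)))

  module _ (g : Fin n) where

    after : ℕ → Fin n
    after j = fromℕ< (m%n<n (suc (toℕ g + j)) n)

    toℕ-after : ∀ j → toℕ (after j) ≡ suc (toℕ g + j) % n
    toℕ-after j = toℕ-fromℕ< (m%n<n (suc (toℕ g + j)) n)

    arc : List (Fin n)
    arc = applyUpTo after N

    after-≢ : ∀ i d → suc d < n → after i ≢ after (i + suc d)
    after-≢ i d d<n eq = %-shift-≢ (suc (toℕ g + i)) d d<n
      (trans (sym (toℕ-after i)) (trans (cong toℕ eq) (trans (toℕ-after _)
        (cong (λ x → suc x % n) (sym (+-assoc (toℕ g) i (suc d)))))))

    after-≢′ : ∀ {i j} → i < j → j < n → after i ≢ after j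
    after-≢′ {i} i<j j<n with m≤n⇒∃[o]m+o≡n i<j
    ... | d , refl rewrite sym (+-suc i d) = after-≢ i d (≤-<-trans (m≤n+m (suc d) i) j<n)

    arc-unique : Unique arc
    arc-unique = Unique.applyUpTo⁺₁ after N λ i<j j<N → after-≢′ i<j (m<n⇒m<1+n j<N)

    toℕ-after-N : toℕ (after N) ≡ toℕ g
    toℕ-after-N = trans (toℕ-after N) (trans (cong (_% n) (sym (+-suc (toℕ g) N)))
      (trans ([m+n]%n≡m%n (toℕ g) n) (m<n⇒m%n≡m (toℕ<n g))))

    gap∉arc : All (g ≢_) arc
    gap∉arc = All.applyUpTo⁺₁ after N λ i<N g≡ →
      after-≢′ i<N ≤-refl (toℕ-injective (trans (cong toℕ (sym g≡)) (sym toℕ-after-N)))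

    arc-complete : ∀ {v} → v ≢ g → v ∈ˡ arc
    arc-complete {v} v≢g = subst (_∈ˡ arc) (toℕ-injective after-j) (∈-applyUpTo⁺ after j<N)
      where
      -- Modulo `n`, the difference `N ∸ toℕ g` is the negative of `suc (toℕ g)`, so `j` inverts
      -- `after`.
      k = toℕ v + (N ∸ toℕ g)
      j = k % n

      sum : k + suc (toℕ g) ≡ toℕ v + n
      sum = trans (+-assoc (toℕ v) (N ∸ toℕ g) (suc (toℕ g)))
        (cong (toℕ v +_) (trans (+-suc _ (toℕ g)) (cong suc (m∸n+n≡m (s≤s⁻¹ (toℕ<n g))))))

      after-j : toℕ (after j) ≡ toℕ v
      after-j = trans (toℕ-after j) (trans (cong (_% n) (+-comm (suc (toℕ g)) j))
        (trans (%-cong-+ j k (suc (toℕ g)) (m%n%n≡m%n k n)) (trans (cong (_% n) sum)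
        (trans ([m+n]%n≡m%n (toℕ v) n) (m<n⇒m%n≡m (toℕ<n v))))))

      j<N : j < N
      j<N = ≤∧≢⇒< (s≤s⁻¹ (m%n<n k n)) λ j≡N →
        v≢g (toℕ-injective (trans (sym after-j) (trans (cong (toℕ ∘ after) j≡N) toℕ-after-N)))

    arc-induced : InducedPath (cycle n) arc
    arc-induced = InducedPath-applyUpTo (cycle n) after N
      (λ i l → after-≢′ ≤-refl (m<n⇒m<1+n l) , inj₁ (%⇒Next (next i)))
      λ { i j l u (_ , inj₁ e) → forward i j l u e ; i j l u (_ , inj₂ e) → backward i j l u e }
      where
      next : ∀ i → toℕ (after (suc i)) ≡ suc (toℕ (after i)) % n
      next i = trans (toℕ-after (suc i)) (trans (cong (λ x → suc x % n) (+-suc (toℕ g) i))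
        (trans (sym (%-suc _)) (cong (λ x → suc x % n) (sym (toℕ-after i)))))

      forward : ∀ i j → suc i < j → j < N → ¬ Next (after i) (after j)
      forward i j l u e = after-≢′ l (m<n⇒m<1+n u) (toℕ-injective (trans (next i) (sym (Next⇒% e))))

      backward : ∀ i j → suc i < j → j < N → ¬ Next (after j) (after i)
      -- Here `suc j` may equal `N`, and `after N` is the cut vertex `g` itself; this is why
      -- `after-≢′` covers all indices below `n`.
      backward i j l u e = after-≢′ (m<n⇒m<1+n (<⇒≤ l)) (s≤s u)
        (toℕ-injective (trans (Next⇒% e) (sym (next j))))

-- Counting what is left of a subset

private
  variable
    k m n : ℕ

halve : ∀ n → ∃ λ k → n ≡ k * 2 ⊎ n ≡ suc (k * 2)
halve 0 = 0 , inj₁ refl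
halve 1 = 0 , inj₂ refl
halve (suc (suc n)) with halve n
... | k , inj₁ eq = suc k , inj₁ (cong (2 +_) eq)
... | k , inj₂ eq = suc k , inj₂ (cong (2 +_) eq)

∪-⁅⁆ : ∀ (p : Subset k) v → p ∪ ⁅ v ⁆ ≡ p [ v ]≔ true
∪-⁅⁆ (b ∷ p) zero    = cong₂ _∷_ (∨-zeroʳ b) (∪-identityʳ p)
∪-⁅⁆ (b ∷ p) (suc v) = cong₂ _∷_ (∨-identityʳ b) (∪-⁅⁆ p v)

∉⇒lookup : ∀ {p : Subset k} {v} → v ∉ p → lookup p v ≡ false
∉⇒lookup {p = p} {v} v∉p with lookup p v in eq
... | false = refl
... | true  = contradiction (lookup⇒[]= v p eq) v∉p

lookup⇒∉ : ∀ {p : Subset k} {v} → lookup p v ≡ false → v ∉ p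
lookup⇒∉ eq v∈p = contradiction (trans (sym eq) ([]=⇒lookup v∈p)) λ ()

one-left : ∀ (p : Subset k) {a} → ∣ ∁ p ∣ ≡ suc a → ∃ λ v → lookup p v ≡ false
one-left (false ∷ p) _ = zero , refl
one-left (true ∷ p) eq = let (v , v≡) = one-left p eq in suc v , v≡

two-left : ∀ (p : Subset k) → 2 ≤ ∣ ∁ p ∣ →
           ∃₂ λ u v → u ≢ v × lookup p u ≡ false × lookup p v ≡ false
two-left (true ∷ p) l =
  let (u , v , u≢v , u≡ , v≡) = two-left p l in suc u , suc v , u≢v ∘ Fin.suc-injective , u≡ , v≡
two-left (false ∷ p) (s≤s l) with ∣ ∁ p ∣ in eq
... | suc _ = let (v , v≡) = one-left p eq in zero , suc v , (λ ()) , refl , v≡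

left-size : ∀ (p : Subset k) {v} → lookup p v ≡ false → ∣ ∁ p ∣ ≡ suc ∣ ∁ (p [ v ]≔ true) ∣
left-size (false ∷ p) {zero} _   = refl
left-size (true ∷ p) {suc v} eq  = left-size p eq
left-size (false ∷ p) {suc v} eq = cong suc (left-size p eq)

left-before : ∀ (p : Subset k) u {v} → lookup (p [ u ]≔ true) v ≡ false → lookup p v ≡ false
left-before p u {v} eq with v ≟ u
... | yes refl = contradiction (trans (sym (lookup∘update u p true)) eq) λ ()
... | no v≢u   = trans (sym (lookup∘update′ v≢u p true)) eq

at-most-one-left : ∀ (p : Subset k) {u v} → ∣ ∁ p ∣ ≤ 1 →
                   lookup p u ≡ false → lookup p v ≡ false → u ≡ v
at-most-one-left p {u} {v} l u≡ v≡ with u ≟ v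
... | yes eq = eq
... | no u≢v = contradiction
  (≤-trans (≤-reflexive (sym (trans (left-size p u≡) (cong suc (left-size (p [ u ]≔ true) v≡′))))) l)
  λ { (s≤s ()) }
  where v≡′ = trans (lookup∘update′ (u≢v ∘ sym) p true) v≡

-- Adjacency and convex sets in the wheel

module _ (m n : ℕ) where

  private
    module W = Graph (wheel m n)
    module C = Graph (cycle n)

  data Vertex : Fin (m + n) → Set where
    hub : ∀ i → Vertex (i ↑ˡ n)
    rim : ∀ r → Vertex (m ↑ʳ r)

  vertex : ∀ v → Vertex v
  vertex v with splitAt m v | join-splitAt m n v
  ... | inj₁ i | refl = hub i
  ... | inj₂ r | refl = rim r

  hub-rim : ∀ i r → W.Adj (i ↑ˡ n) (m ↑ʳ r)
  hub-rim i r rewrite splitAt-↑ˡ m i n | splitAt-↑ʳ m n r = tt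

  hub-hub : ∀ i j → ¬ W.Adj (i ↑ˡ n) (j ↑ˡ n)
  hub-hub i j rewrite splitAt-↑ˡ m i n | splitAt-↑ˡ m j n = λ ()

  rim-rim : ∀ {r s} → C.Adj r s → W.Adj (m ↑ʳ r) (m ↑ʳ s)
  rim-rim {r} {s} e rewrite splitAt-↑ʳ m n r | splitAt-↑ʳ m n s = e

  rim-rim⁻¹ : ∀ {r s} → W.Adj (m ↑ʳ r) (m ↑ʳ s) → C.Adj r s
  rim-rim⁻¹ {r} {s} e rewrite splitAt-↑ʳ m n r | splitAt-↑ʳ m n s = e

  hub-injective : ∀ {i j} → i ↑ˡ n ≡ j ↑ˡ n → i ≡ j
  hub-injective {i} {j} eq = inj₁-injective
    (trans (sym (splitAt-↑ˡ m i n)) (trans (cong (splitAt m) eq) (splitAt-↑ˡ m j n)))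

  rim-injective : ∀ {r s} → m ↑ʳ r ≡ m ↑ʳ s → r ≡ s
  rim-injective {r} {s} eq = inj₂-injective
    (trans (sym (splitAt-↑ʳ m n r)) (trans (cong (splitAt m) eq) (splitAt-↑ʳ m n s)))

  module _ {K} (convex : Convex (wheel m n) K) where

    hubs⇒rim : ∀ {i j} → i ≢ j → i ↑ˡ n ∈ K → j ↑ˡ n ∈ K → ∀ r → m ↑ʳ r ∈ K
    hubs⇒rim {i} {j} i≢j i∈ j∈ r = convex-common (wheel m n) convex i∈ j∈
      (i≢j ∘ hub-injective) (hub-hub i j) (hub-rim i r) (W.symm (hub-rim j r))

    rims⇒hub : ∀ {r s} → r ≢ s → ¬ C.Adj r s → m ↑ʳ r ∈ K → m ↑ʳ s ∈ K → ∀ i → i ↑ˡ n ∈ K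
    rims⇒hub {r} {s} r≢s ¬adj r∈ s∈ i = convex-common (wheel m n) convex r∈ s∈
      (r≢s ∘ rim-injective) (¬adj ∘ rim-rim⁻¹) (W.symm (hub-rim i r)) (hub-rim i s)

-- Generating sets of the wheel, and the states of positions

module _ (m n : ℕ) where

  private
    M = 2 + m
    N = 4 + n
    G = wheel M N

  -- This rests on the rim having at least four vertices: in a triangle, 2 would be followed by 0.
  rims-apart : ¬ Graph.Adj (cycle N) zero (suc (suc zero))
  rims-apart (_ , inj₁ (inj₁ ()))
  rims-apart (_ , inj₁ (inj₂ ()))
  rims-apart (_ , inj₂ (inj₁ ()))
  rims-apart (_ , inj₂ (inj₂ (() , _)))

  -- Two hub vertices pull in the whole rim, and two non-adjacent rim vertices then pull in the
  -- whole hub.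
  generating-hubs : ∀ {S : Subset (M + N)} {i j} → i ≢ j → i ↑ˡ N ∈ S → j ↑ˡ N ∈ S → Generating G S
  generating-hubs {S} i≢j i∈ j∈ = (λ _ → ∈⊤) , (λ _ _ _ _ _ → ∈⊤) , hull
    where
    hull : ∀ K → Convex G K → (∀ {v} → v ∈ S → v ∈ K) → ∀ {v} → v ∈ ⊤ → v ∈ K
    hull K convex S⊆K {v} _ with vertex M N v
    ... | rim r = hubs⇒rim M N convex i≢j (S⊆K i∈) (S⊆K j∈) r
    ... | hub i = rims⇒hub M N convex {zero} {suc (suc zero)} (λ ()) rims-apart (rims _) (rims _) i
      where rims = hubs⇒rim M N convex i≢j (S⊆K i∈) (S⊆K j∈)

  generating-rims : ∀ {S : Subset (M + N)} {r s} → r ≢ s → ¬ Graph.Adj (cycle N) r s →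
                    M ↑ʳ r ∈ S → M ↑ʳ s ∈ S → Generating G S
  generating-rims {S} r≢s ¬adj r∈ s∈ = (λ _ → ∈⊤) , (λ _ _ _ _ _ → ∈⊤) , hull
    where
    hull : ∀ K → Convex G K → (∀ {v} → v ∈ S → v ∈ K) → ∀ {v} → v ∈ ⊤ → v ∈ K
    hull K convex S⊆K {v} _ with vertex M N v
    ... | hub i = rims⇒hub M N convex r≢s ¬adj (S⊆K r∈) (S⊆K s∈) i
    ... | rim r = hubs⇒rim M N convex {zero} {suc zero} (λ ()) (hubs _) (hubs _) r
      where hubs = rims⇒hub M N convex r≢s ¬adj (S⊆K r∈) (S⊆K s∈)

  -- Being convex, a generating clique would contain every vertex, among them two hub vertices,
  -- which are not adjacent.
  clique-not-generating : ∀ {S} → IsClique G S → ¬ Generating G S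
  clique-not-generating clique gen with clique (all (zero {1 + m} ↑ˡ N)) (all (suc (zero {m}) ↑ˡ N))
    where all = clique-generating G clique gen
  ... | inj₁ ()
  ... | inj₂ e = hub-hub M N zero (suc zero) e

  -- P is the set of deleted vertices.  In the case cut, the list vs starts next to
  -- a deleted rim vertex and runs once around the rim.
  data Represents (P : Subset (M + N)) : State → Set where
    cut   : ∀ {q e} (h : Subset M) (c : Subset N) vs → P ≡ h ++ c →
            Unique vs → InducedPath (cycle N) vs → (∀ {r} → lookup c r ≡ false → r ∈ˡ vs) →
            Runs (map (lookup c) vs) q e → ∀ {a} → a ≡ ∣ ∁ h ∣ → Represents P (runs q a e)
    even  : ∀ k (h : Subset M) → P ≡ h ++ ⊥ → N ≡ k * 2 →
            ∀ {a} → a ≡ ∣ ∁ h ∣ → Represents P (runs k a 0)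
    odd   : ∀ k (h : Subset M) → P ≡ h ++ ⊥ → N ≡ suc (k * 2) →
            ∀ {a} → a ≡ ∣ ∁ h ∣ → Represents P (oddCycle k a)

  module _ (h : Subset M) (c : Subset N) where

    hub-∉ : ∀ {i} → lookup h i ≡ false → i ↑ˡ N ∉ h ++ c
    hub-∉ {i} eq = lookup⇒∉ (trans (lookup-++ˡ h c i) eq)

    rim-∉ : ∀ {r} → lookup c r ≡ false → M ↑ʳ r ∉ h ++ c
    rim-∉ {r} eq = lookup⇒∉ (trans (lookup-++ʳ h c r) eq)

    hub-left : ∀ {i} → i ↑ˡ N ∉ h ++ c → lookup h i ≡ false
    hub-left {i} i∉ = trans (sym (lookup-++ˡ h c i)) (∉⇒lookup i∉)

    rim-left : ∀ {r} → M ↑ʳ r ∉ h ++ c → lookup c r ≡ false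
    rim-left {r} r∉ = trans (sym (lookup-++ʳ h c r)) (∉⇒lookup r∉)

    delete-hub : ∀ i → (h ++ c) ∪ ⁅ i ↑ˡ N ⁆ ≡ (h [ i ]≔ true) ++ c
    delete-hub i = trans (∪-⁅⁆ (h ++ c) (i ↑ˡ N)) ([]≔-++-↑ˡ h c i)

    delete-rim : ∀ r → (h ++ c) ∪ ⁅ M ↑ʳ r ⁆ ≡ h ++ (c [ r ]≔ true)
    delete-rim r = trans (∪-⁅⁆ (h ++ c) (M ↑ʳ r)) ([]≔-++-↑ʳ h c r)

    generating-two : 2 ≤ ∣ ∁ h ∣ → Generating G (∁ (h ++ c))
    generating-two l = let (i , j , i≢j , i≡ , j≡) = two-left h l in
      generating-hubs i≢j (x∉p⇒x∈∁p (hub-∉ i≡)) (x∉p⇒x∈∁p (hub-∉ j≡))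

    module _ {q e} vs (r : Runs (map (lookup c) vs) q e) (ind : InducedPath (cycle N) vs) where

      live⇒generating : Unique vs → Live q ∣ ∁ h ∣ e → Generating G (∁ (h ++ c))
      live⇒generating _ (inj₁ l)  = generating-two l
      live⇒generating uq (inj₂ l) =
        let (u , v , u≢v , ¬adj , u≡ , v≡) = nonadjacent (cycle N) c vs uq ind r l in
        generating-rims u≢v ¬adj (x∉p⇒x∈∁p (rim-∉ u≡)) (x∉p⇒x∈∁p (rim-∉ v≡))

      ended-clique : (∀ {r} → lookup c r ≡ false → r ∈ˡ vs) → ∣ ∁ h ∣ ≤ 1 → q + e ≤ 1 →
                     IsClique G (∁ (h ++ c))
      ended-clique ∈vs a≤1 p≤1 {u} {v} u∈ v∈ = go (vertex M N u) (vertex M N v) (x∈∁p⇒x∉p u∈) (x∈∁p⇒x∉p v∈)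
        where
        go : ∀ {u v} → Vertex M N u → Vertex M N v → u ∉ h ++ c → v ∉ h ++ c → u ≡ v ⊎ Graph.Adj G u v
        go (hub i) (hub j) i∉ j∉ = inj₁ (cong (_↑ˡ N) (at-most-one-left h a≤1 (hub-left i∉) (hub-left j∉)))
        go (hub i) (rim s) _ _ = inj₂ (hub-rim M N i s)
        go (rim s) (hub i) _ _ = inj₂ (Graph.symm G {i ↑ˡ N} {M ↑ʳ s} (hub-rim M N i s))
        go (rim s) (rim t) s∉ t∉
          with adjacent (cycle N) c vs ind r p≤1
                 (∈vs (rim-left s∉)) (∈vs (rim-left t∉)) (rim-left s∉) (rim-left t∉)
        ... | inj₁ eq = inj₁ (cong (M ↑ʳ_) eq)
        ... | inj₂ e  = inj₂ (rim-rim M N e)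

      generating⇒live : (∀ {r} → lookup c r ≡ false → r ∈ˡ vs) → Generating G (∁ (h ++ c)) →
                        Live q ∣ ∁ h ∣ e
      generating⇒live ∈vs gen with 2 ≤? ∣ ∁ h ∣ | 2 ≤? q + e
      ... | yes l | _     = inj₁ l
      ... | no _  | yes l = inj₂ l
      ... | no ¬a | no ¬p = contradiction gen
        (clique-not-generating (ended-clique ∈vs (s≤s⁻¹ (≰⇒> ¬a)) (s≤s⁻¹ (≰⇒> ¬p))))

  module _ (h : Subset M) where

    generating-whole : Generating G (∁ (h ++ ⊥))
    generating-whole = generating-rims {r = zero} {suc (suc zero)} (λ ()) rims-apart
      (x∉p⇒x∈∁p (rim-∉ h ⊥ {zero} refl)) (x∉p⇒x∈∁p (rim-∉ h ⊥ {suc (suc zero)} refl))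

    -- The remaining rim is one path of `3 + n` vertices, and `free` reads off its parameters;
    -- leaving them open serves both parities of the rim.
    open-cycle : ∀ r {q e} → (∀ l → List.length l ≡ 3 + n → All (_≡ false) l → Runs l q e) →
                 Represents (h ++ (⊥ [ r ]≔ true)) (runs q ∣ ∁ h ∣ e)
    open-cycle r free = cut h (⊥ [ r ]≔ true) (arc r) refl (arc-unique r) (arc-induced r)
      (λ {s} s≡ → arc-complete r λ { refl → contradiction (trans (sym (lookup∘update r (⊥ {N}) true)) s≡) λ () })
      (free _ (trans (length-map _ (arc r)) (length-applyUpTo (after r) (3 + n)))
        (All.map⁺ (All.map (λ {s} r≢s → trans (lookup∘update′ (r≢s ∘ sym) ⊥ true) (lookup-replicate s false)) (gap∉arc r))))
        refl

  runs-even : ∀ k l → List.length l ≡ k * 2 → All (_≡ false) l → Runs l k 0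
  runs-even zero [] _ _ = []
  runs-even (suc k) (_ ∷ _ ∷ l) eq (refl ∷ refl ∷ fs) = pair (runs-even k l (cong (λ n → n ∸ 2) eq) fs)

  runs-odd : ∀ k l → List.length l ≡ suc (k * 2) → All (_≡ false) l → Runs l k 1
  runs-odd zero (_ ∷ []) _ (refl ∷ []) = last
  runs-odd (suc k) (_ ∷ _ ∷ l) eq (refl ∷ refl ∷ fs) = pair (runs-odd k l (cong (λ n → n ∸ 2) eq) fs)

  -- A whole even rim has `k ≥ 2`, which alone makes its state live, however many hub vertices are
  -- left.
  even-size : ∀ k → N ≡ k * 2 → ∃ λ j → k ≡ 2 + j × 3 + n ≡ suc (suc j * 2)
  even-size (suc (suc j)) N≡ = j , refl , suc-injective N≡

  -- Together with `back` this makes `Represents` a bisimulation, through which positions inherit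
  -- the values of states.
  forth : ∀ {P s Q} → Represents P s → Move G P Q → ∃ λ t → s ↦ t × Represents Q t
  forth (cut h c vs refl uq ind ∈vs r refl) (gen , v , v∉ , refl)
    with vertex M N v | generating⇒live h c vs r ind ∈vs gen
  -- The rewriting exhibits the number of hub vertices left as a successor, the shape that the `hub`
  -- move requires.
  ... | hub i | live rewrite left-size h (hub-left h c v∉) =
    _ , hub live , cut (h [ i ]≔ true) c vs (delete-hub h c i) uq ind ∈vs r refl
  ... | rim s | live with delete r (update-Delete c uq (∈vs (rim-left h c v∉)) (rim-left h c v∉))
  ...   | inj₁ (_ , refl , r′) =
    _ , lone live , cut h (c [ s ]≔ true) vs (delete-rim h c s) uq ind (∈vs ∘ left-before c s) r′ refl
  ...   | inj₂ (_ , refl , r′) =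
    _ , pair live , cut h (c [ s ]≔ true) vs (delete-rim h c s) uq ind (∈vs ∘ left-before c s) r′ refl
  forth (even k h refl N≡ refl) (_ , v , v∉ , refl) with even-size k N≡ | vertex M N v
  ... | j , refl , _  | hub i rewrite left-size h (hub-left h ⊥ v∉) =
    _ , hub (inj₂ 2≤₊) , even (2 + j) (h [ i ]≔ true) (delete-hub h ⊥ i) N≡ refl
  ... | j , refl , l≡ | rim r rewrite delete-rim h ⊥ r =
    _ , pair (inj₂ 2≤₊) , open-cycle h r (λ l eq → runs-odd (suc j) l (trans eq l≡))
  forth (odd k h refl N≡ refl) (_ , v , v∉ , refl) with vertex M N v
  ... | hub i rewrite left-size h (hub-left h ⊥ v∉) = _ , hub-odd , odd k (h [ i ]≔ true) (delete-hub h ⊥ i) N≡ refl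
  ... | rim r rewrite delete-rim h ⊥ r =
    _ , cut-open , open-cycle h r (λ l eq → runs-even k l (trans eq (suc-injective N≡)))

  move-hub : ∀ h c i → lookup h i ≡ false → Generating G (∁ (h ++ c)) → Move G (h ++ c) ((h [ i ]≔ true) ++ c)
  move-hub h c i i≡ gen = gen , i ↑ˡ N , hub-∉ h c i≡ , sym (delete-hub h c i)

  move-rim : ∀ h c r → lookup c r ≡ false → Generating G (∁ (h ++ c)) → Move G (h ++ c) (h ++ (c [ r ]≔ true))
  move-rim h c r r≡ gen = gen , M ↑ʳ r , rim-∉ h c r≡ , sym (delete-rim h c r)

  back : ∀ {P s t} → Represents P s → s ↦ t → ∃ λ Q → Move G P Q × Represents Q t
  back (cut {q} {e} h c vs refl uq ind ∈vs r a≡) (hub live) =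
    let (i , i≡) = one-left h (sym a≡) in
    _ , move-hub h c i i≡ (live⇒generating h c vs r ind uq (subst (λ a → Live q a e) a≡ live)) ,
    cut _ c vs refl uq ind ∈vs r (suc-injective (trans a≡ (left-size h i≡)))
  back (cut {q} {e} h c vs refl uq ind ∈vs r refl) (lone live) with delete-lone r
  ... | _ , d , r′ with Delete-update c vs uq d
  ...   | v , _ , v≡ , refl = _ , move-rim h c v v≡ (live⇒generating h c vs r ind uq live) ,
    cut h _ vs refl uq ind (∈vs ∘ left-before c v) r′ refl
  back (cut {q} {e} h c vs refl uq ind ∈vs r refl) (pair live) with delete-pair r
  ... | _ , d , r′ with Delete-update c vs uq d
  ...   | v , _ , v≡ , refl = _ , move-rim h c v v≡ (live⇒generating h c vs r ind uq live) ,
    cut h _ vs refl uq ind (∈vs ∘ left-before c v) r′ refl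
  back (even k h refl N≡ a≡) (hub _) =
    let (i , i≡) = one-left h (sym a≡) in
    _ , move-hub h ⊥ i i≡ (generating-whole h) , even k _ refl N≡ (suc-injective (trans a≡ (left-size h i≡)))
  back (even (suc k) h refl N≡ refl) (pair _) =
    _ , move-rim h ⊥ zero refl (generating-whole h) ,
    open-cycle h zero (λ l eq → runs-odd k l (trans eq (suc-injective N≡)))
  back (odd k h refl N≡ a≡) hub-odd =
    let (i , i≡) = one-left h (sym a≡) in
    _ , move-hub h ⊥ i i≡ (generating-whole h) , odd k _ refl N≡ (suc-injective (trans a≡ (left-size h i≡)))
  back (odd k h refl N≡ refl) cut-open =
    _ , move-rim h ⊥ zero refl (generating-whole h) ,
    open-cycle h zero (λ l eq → runs-even k l (trans eq (suc-injective N≡)))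

  -- The nim-value of the starting position

  open Position

  Assigned : ℕ → Position G → ℕ → Set
  Assigned b p v = ∃ λ s → size s ≡ b × Represents (set p) s × Valueˢ s v

  hasNim-state : ∀ {p s v} → Represents (set p) s → Valueˢ s v → HasNim (TER G) p v
  hasNim-state {s = s} R V =
    hasNim (TER G) Assigned (λ {b} {p} {v} {q} → excludes′ {b} {p} {v} {q})
      (λ {b} {p} {v} → attains′ {b} {p} {v}) (size s) (s , refl , R , V)
    where
    excludes′ : ∀ {b p v q} → Assigned b p v → Move G (set p) (set q) →
                ∃₂ λ b′ w → b ≡ suc b′ × Assigned b′ q w × w ≢ v
    excludes′ (s , refl , R , V) move with forth R move
    ... | t , step , R′ with excludes (valueˢ-mex V) step
    ...   | w , V′ , w≢v = size t , w , ↦-size step , (t , refl , R′ , V′) , w≢v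

    attains′ : ∀ {b p v j} → Assigned b p v → j < v →
               ∃₂ λ b′ q → b ≡ suc b′ × Move G (set p) (set q) × Assigned b′ q j
    attains′ {p = position P reach} (s , refl , R , V) j<v with attains (valueˢ-mex V) j<v
    ... | t , step , V′ with back R step
    ...   | Q , move , R′ = size t , position Q (reach ◅◅ (move ◅ ε)) , ↦-size step , move , (t , refl , R′ , V′)

  start-represented : ∀ k → (N ≡ k * 2 → Represents ⊥ (runs k M 0)) × (N ≡ suc (k * 2) → Represents ⊥ (oddCycle k M))
  start-represented k = (λ N≡ → even k ⊥ (⊥-++ M) N≡ M≡) , λ N≡ → odd k ⊥ (⊥-++ M) N≡ M≡
    where
    ⊥-++ : ∀ k → ⊥ {k + N} ≡ ⊥ {k} ++ ⊥ {N}
    ⊥-++ zero    = refl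
    ⊥-++ (suc k) = cong (false ∷_) (⊥-++ k)

    M≡ : M ≡ ∣ ∁ (⊥ {M}) ∣
    M≡ = sym (trans (∣∁p∣≡n∸∣p∣ (⊥ {M})) (cong (M ∸_) (∣⊥∣≡0 M)))

  Prediction : State → Set
  Prediction s = (2 + M ≤ N → Valueˢ s (par (suc (N + M))))
               × (N ≤ M → Valueˢ s (par (N + M)))
               × (N ≡ suc M → Valueˢ s 2)

  -- At the start D = M ≥ 2, which lies beyond `few` and `ridge₁`. As 2q = N, what remains is
  -- `between` for N ≥ M + 2, `ridge₂` for N = M + 1 and `many` for N ≤ M.
  predict-even : ∀ j → N ≡ suc j * 2 → Prediction (runs (suc j) M 0)
  predict-even j N≡ =
      (λ l → cast (trans (cong (λ x → par (suc x)) (+-identityʳ M)) (sym par-suc-N+M))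
               (between 2≤₊ (≤-trans l (≤-reflexive N≡′))))
    , (λ l → cast (trans (cong par (+-identityʳ M)) (sym par-N+M)) (many (≤-trans (≤-reflexive (sym N≡′)) l)))
    , (λ eq → runs (ridge₂ 2≤₊ (trans (sym eq) N≡′)))
    where
    N≡′ : N ≡ suc j * 2 + 0
    N≡′ = trans N≡ (sym (+-identityʳ _))

    par-N+M : par (N + M) ≡ par M
    par-N+M = trans (cong (λ x → par (x + M)) N≡) (par-*2+ (suc j) M)

    par-suc-N+M : par (suc (N + M)) ≡ par (suc M)
    par-suc-N+M = trans (cong (λ x → par (suc (x + M))) N≡) (par-suc-*2+ (suc j) M)

  -- The threshold for a whole odd rim is N - 1, so `below`, `at` and `above` give the same three
  -- ranges. The odd N shifts the parity of N + M against that of M, which matches the shifted phase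
  -- of these values.
  predict-odd : ∀ j → N ≡ suc ((2 + j) * 2) → Prediction (oddCycle (2 + j) M)
  predict-odd j N≡ =
      (λ l → subst (Valueˢ _) (sym par-suc-N+M) (below (s≤s⁻¹ (≤-trans l (≤-reflexive N≡)))))
    , (λ l → subst (Valueˢ _) (sym par-N+M) (above (≤-trans (≤-reflexive (sym N≡)) l)))
    , (λ eq → at (suc-injective (trans (sym eq) N≡)))
    where
    par-N+M : par (N + M) ≡ par (suc M)
    par-N+M = trans (cong (λ x → par (x + M)) N≡) (par-suc-*2+ (2 + j) M)

    par-suc-N+M : par (suc (N + M)) ≡ par M
    par-suc-N+M = trans (cong (λ x → par (suc (x + M))) N≡) (par-*2+ (2 + j) M)

  nims : (2 + M ≤ N → GameHasNim (TER G) (par (suc (N + M))))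
       × (N ≤ M → GameHasNim (TER G) (par (N + M)))
       × (N ≡ suc M → GameHasNim (TER G) 2)
  nims with halve N
  ... | suc j , inj₁ N≡ = let (large , small , equal) = predict-even j N≡ in
    start large , start small , start equal
    where
    start : ∀ {A : Set} {v} → (A → Valueˢ _ v) → A → GameHasNim (TER G) v
    start f x = hasNim-state (proj₁ (start-represented (suc j)) N≡) (f x)
  -- An odd number of at least four rim vertices is at least five, so `k ≥ 2`, as the values of
  -- whole odd rims require.
  ... | suc (suc j) , inj₂ N≡ = let (large , small , equal) = predict-odd j N≡ in
    start large , start small , start equal
    where
    start : ∀ {A : Set} {v} → (A → Valueˢ _ v) → A → GameHasNim (TER G) v
    start f x = hasNim-state (proj₂ (start-represented (2 + j)) N≡) (f x)

-- Translation to divisibility and to the integer d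

2∣⇒par : ∀ {x} → 2 ∣ x → par x ≡ 1 × par (suc x) ≡ 0
2∣⇒par (divides k refl) =
  trans (cong par (sym (+-identityʳ (k * 2)))) (par-*2+ k 0) ,
  trans (cong (λ n → par (suc n)) (sym (+-identityʳ (k * 2)))) (par-suc-*2+ k 0)

2∤⇒par : ∀ {x} → 2 ∤ x → par x ≡ 0 × par (suc x) ≡ 1
2∤⇒par {0} 2∤x           = contradiction (2 ∣0) 2∤x
2∤⇒par {1} _             = refl , refl
2∤⇒par {suc (suc x)} 2∤x = 2∤⇒par (λ 2∣x → 2∤x (∣m∣n⇒∣m+n ∣-refl 2∣x))

open import Data.Integer using (ℤ; +_; _-_) renaming (_≤_ to _≤ᶻ_; _+_ to _+ᶻ_)

-+-cancel : ∀ m n → (+ n - + m) +ᶻ + m ≡ + n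
-+-cancel m n = Algebra.Properties.AbelianGroup.//-rightDividesˡ ℤ.+-0-abelianGroup (+ m) (+ n)

theorem5p43 : ∀ (m n : ℕ) → 2 ≤ m → 4 ≤ n →
    let d : ℤ
        d = + n - + m
    in  (2 ∣ n + m → + 2 ≤ᶻ d → GameHasNim (TER (wheel m n)) 0)
      × (2 ∤ n + m → d ≤ᶻ + 0 → GameHasNim (TER (wheel m n)) 0)
      × (2 ∣ n + m → d ≤ᶻ + 0 → GameHasNim (TER (wheel m n)) 1)
      × (2 ∤ n + m → + 2 ≤ᶻ d → GameHasNim (TER (wheel m n)) 1)
      × (d ≡ + 1 → GameHasNim (TER (wheel m n)) 2)
theorem5p43 (suc (suc m)) (suc (suc (suc (suc n)))) (s≤s (s≤s z≤n)) (s≤s (s≤s (s≤s (s≤s z≤n)))) =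
    (λ 2∣ d≥2 → subst Nim (proj₂ (2∣⇒par 2∣)) (large (2+m≤n d≥2)))
  , (λ 2∤ d≤0 → subst Nim (proj₁ (2∤⇒par 2∤)) (small (n≤m d≤0)))
  , (λ 2∣ d≤0 → subst Nim (proj₁ (2∣⇒par 2∣)) (small (n≤m d≤0)))
  , (λ 2∤ d≥2 → subst Nim (proj₂ (2∤⇒par 2∤)) (large (2+m≤n d≥2)))
  , (λ d≡1 → equal (ℤ.+-injective (trans (sym (-+-cancel M N)) (cong (_+ᶻ + M) d≡1))))
  where
  M = 2 + m
  N = 4 + n
  Nim = GameHasNim (TER (wheel M N))
  large = proj₁ (nims m n)
  small = proj₁ (proj₂ (nims m n))
  equal = proj₂ (proj₂ (nims m n))

  2+m≤n : + 2 ≤ᶻ + N - + M → 2 + M ≤ N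
  2+m≤n l = ℤ.drop‿+≤+ (subst (+ (2 + M) ≤ᶻ_) (-+-cancel M N) (ℤ.+-monoˡ-≤ (+ M) l))

  n≤m : + N - + M ≤ᶻ + 0 → N ≤ M
  n≤m l = ℤ.drop‿+≤+ (ℤ.i-j≤0⇒i≤j l)
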